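{- Let $n\ge1$ and let $m_1,\dots,m_{2n+2}$ be nonzero integers. Let $D$ be the (standard) diagram of the vertical rational link $m_1m_2\cdots m_{2n+2}$, whose associated signed plane graph is $\widehat{VF_n}$ as described in the context. Put $B=A^{ -1}$, $d=-A^2-A^{ -2}$, $X=-A^{ -3}$, $Y=-A^{3}$. Then $$\langle m_1m_2\cdots m_{2n+2}\rangle=d^{ -n-2}X_0^T\Big(\prod_{i=1}^nA_i\Big)J,$$ where $J=(1,1)^T$, the product is $A_1A_2\cdots A_n$, $$X_0^T=\big((X^{m_1}-A^{m_1})B^{m_2}d^2,\;A^{m_1}Y^{m_2}d^2+(X^{m_1}-A^{m_1})(Y^{m_2}-B^{m_2})\big),$$ and $$A_i=\begin{pmatrix}X^{m_{2i+1}}B^{m_{2i+2}}d & X^{m_{2i+1}}(Y^{m_{2i+2}}-B^{m_{2i+2}})d^{ -1}\\ (X^{m_{2i+1}}-A^{m_{2i+1}})B^{m_{2i+2}}d & (X^{m_{2i+1}}-A^{m_{2i+1}})(Y^{m_{2i+2}}-B^{m_{2i+2}})d^{ -1}+A^{m_{2i+1}}Y^{m_{2i+2}}d\end{pmatrix}.$$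
   Context: Signed plane graphs correspond to link diagrams via the medial graph: each edge of the signed plane graph becomes a crossing whose type is determined by the edge sign. Kauffman's polynomial $Q[G]\in\mathbb{Z}[A,B,d]$ of a signed graph is determined by $Q[E_n]=d^{n-1}$ ($E_n$ the edgeless graph on $n$ vertices); for a loop $e$: $Q[G]=(A+Bd)Q[G-e]$ if $s(e)=-$, $(Ad+B)Q[G-e]$ if $s(e)=+$; for a non-loop $e$: $Q[G]=AQ[G-e]+BQ[G/e]$ if $s(e)=-$, $BQ[G-e]+AQ[G/e]$ if $s(e)=+$. For a signed plane graph $H$ with link diagram $D(H)$, the Kauffman bracket is $\langle D(H)\rangle=Q[H]|_{B=A^{ -1},\,d=-A^2-A^{ -2}}\in\mathbb{Z}[A,A^{ -1}]$. A chain of length $m$ (nonzero integer) between vertices $u,v$ is a path of $|m|$ edges from $u$ to $v$ through new vertices, all of sign $\mathrm{sgn}(m)$; a sheaf of width $m$ is $|m|$ parallel edges between $u$ and $v$, all of sign $\mathrm{sgn}(m)$. The graph $VF_n$ has vertices $u,v_0,\dots,v_n$, two parallel edges $e,f$ joining $u$ and $v_0$, and, for $i=1,\dots,n$, edges $v_{i-1}v_i$ and $uv_i$. $\widehat{VF_n}$ is obtained by replacing $e$ by a chain of length $m_1$, $f$ by a sheaf of width $m_2$, each $v_{i-1}v_i$ by a chain of length $m_{2i+1}$, and each $uv_i$ by a sheaf of width $m_{2i+2}$. The diagram of the vertical rational link $m_1\cdots m_{2n+2}$ is $D(\widehat{VF_n})$ for a plane embedding, so its Kauffman bracket equals $Q[\widehat{VF_n}]$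 evaluated at $B=A^{ -1}$, $d=-A^2-A^{ -2}$. -}

module Defs where

open import Level using (Level)
open import Data.Nat as ℕ using (ℕ; zero; suc)
open import Data.Integer as ℤ using (ℤ; +_; -[1+_]; ∣_∣; sign)
open import Data.Sign as Sign using (Sign)
open import Data.Product using (_×_; _,_; proj₁; proj₂)
open import Data.List as List using (List; []; _∷_; _++_; replicate)
open import Data.Vec using (Vec; []; _∷_)
open import Relation.Nullary using (does)
open import Data.Bool using (if_then_else_)
open import Algebra.Bundles using (CommutativeRing)

------------------------------------------------------------------------
-- Signed graphs with vertices labelled by natural numbers.
-- An edge is (x , y , s): endpoints x, y and sign s.

Edge : Set
Edge = ℕ × ℕ × Sign

-- A chain of length k (k = |m|) between x and y with sign s, whose
-- k - 1 new internal vertices are labelled f, f+1, ..., f+k-2.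
chain : ℕ → ℕ → Sign → ℕ → ℕ → List Edge
chain x y s zero          f = []
chain x y s (suc zero)    f = (x , y , s) ∷ []
chain x y s (suc (suc j)) f = (x , f , s) ∷ chain f y s (suc j) (suc f)

-- A sheaf of width k between x and y with sign s: k parallel edges.
sheaf : ℕ → ℕ → Sign → ℕ → List Edge
sheaf x y s k = replicate k (x , y , s)

-- The graph \widehat{VF_n}.  Vertex labels: u = 0, v_j = j + 1
-- (j = 0..n); fresh (chain-internal) vertices from n + 2 on.
-- The list of pairs gives (m_{2i+1} , m_{2i+2}) for i = 1..n.
-- 'vfRest i f ps' handles the pairs starting at index i, where the
-- next fresh label is f; it returns the edges and the next fresh label.
vfRest : ℕ → ℕ → List (ℤ × ℤ) → List Edge × ℕ
vfRest i f [] = [] , f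
vfRest i f ((a , b) ∷ ps) =
  let r = vfRest (suc i) (f ℕ.+ ((∣ a ∣) ℕ.∸ 1)) ps in
  (chain i (suc i) (sign a) (∣ a ∣) f            -- edge v_{i-1} v_i
     ++ sheaf 0 (suc i) (sign b) (∣ b ∣)          -- edge u v_i
     ++ proj₁ r) , proj₂ r

vecToList : ∀ {a} {A : Set a} {n : ℕ} → Vec A n → List A
vecToList []       = []
vecToList (x ∷ xs) = x ∷ vecToList xs

-- Edge list and number of vertices of \widehat{VF_n}
-- (vertices are exactly 0, 1, ..., count - 1).
VFhat : (n : ℕ) → ℤ → ℤ → Vec (ℤ × ℤ) n → List Edge × ℕ
VFhat n m₁ m₂ ms =
  let f₀ = suc (suc n)
      r  = vfRest 1 (f₀ ℕ.+ ((∣ m₁ ∣) ℕ.∸ 1)) (vecToList ms) in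
  (chain 0 1 (sign m₁) (∣ m₁ ∣) f₀      -- edge e (u v_0)
     ++ sheaf 0 1 (sign m₂) (∣ m₂ ∣)     -- edge f (u v_0)
     ++ proj₁ r) , proj₂ r

------------------------------------------------------------------------
-- Ring-valued constructions

module WithRing {c ℓ : Level} (R : CommutativeRing c ℓ) where
  open CommutativeRing R

  pow : Carrier → ℕ → Carrier
  pow x zero    = 1#
  pow x (suc k) = x * pow x k

  -- integer power of a unit x with inverse xi
  zpow : Carrier → Carrier → ℤ → Carrier
  zpow x xi (+ k)     = pow x k
  zpow x xi -[1+ k ]  = pow xi (suc k)

  -- Kauffman's polynomial Q[G] evaluated at A = α, B = β, d = δ,
  -- computed by deletion/contraction along the edge list.
  -- 'cnt' is the current number of vertices, 'σ' maps original vertex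
  -- labels to current ones (contractions identify vertices).
  -- Q[E_k] = δ^(k-1).
  Qσ : (α β δ : Carrier) → ℕ → (ℕ → ℕ) → List Edge → Carrier
  Qσ α β δ cnt σ [] = pow δ (cnt ℕ.∸ 1)
  Qσ α β δ cnt σ ((x , y , s) ∷ es) with does (σ x ℕ.≟ σ y) | s
  ... | Data.Bool.true  | Sign.- = (α + β * δ) * Qσ α β δ cnt σ es
  ... | Data.Bool.true  | Sign.+ = (α * δ + β) * Qσ α β δ cnt σ es
  ... | Data.Bool.false | Sign.- = α * Qσ α β δ cnt σ es + β * Qσ α β δ (cnt ℕ.∸ 1) σ' es
    where σ' : ℕ → ℕ
          σ' w = if does (σ w ℕ.≟ σ y) then σ x else σ w
  ... | Data.Bool.false | Sign.+ = β * Qσ α β δ cnt σ es + α * Qσ α β δ (cnt ℕ.∸ 1) σ' es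
    where σ' : ℕ → ℕ
          σ' w = if does (σ w ℕ.≟ σ y) then σ x else σ w

  -- Q[G] for a graph given as (edges , number of vertices labelled 0..k-1)
  Q : (α β δ : Carrier) → List Edge × ℕ → Carrier
  Q α β δ (es , k) = Qσ α β δ k (λ w → w) es

  -- Parameters: a stands for A, a⁻ for A^{-1} (= B).
  dval : Carrier → Carrier → Carrier
  dval a a⁻ = - (a * a) + - (a⁻ * a⁻)

  -- X = -A^{-3},  Y = -A^{3}  (mutually inverse)
  Xval : Carrier → Carrier → Carrier
  Xval a a⁻ = - (a⁻ * a⁻ * a⁻)

  Yval : Carrier → Carrier → Carrier
  Yval a a⁻ = - (a * a * a)

  -- Kauffman bracket of the vertical rational link m₁ m₂ ⋯ m_{2n+2}:
  -- Q[\widehat{VF_n}] at B = A^{-1}, d = -A^2 - A^{-2}.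
  bracket : (a a⁻ : Carrier) (n : ℕ) → ℤ → ℤ → Vec (ℤ × ℤ) n → Carrier
  bracket a a⁻ n m₁ m₂ ms = Q a a⁻ (dval a a⁻) (VFhat n m₁ m₂ ms)

  -- 2×2 matrices (row-major) and column vectors
  record M2 : Set c where
    constructor mat
    field m11 m12 m21 m22 : Carrier

  _⊗_ : M2 → M2 → M2
  mat p q r s ⊗ mat p' q' r' s' =
    mat (p * p' + q * r') (p * q' + q * s') (r * p' + s * r') (r * q' + s * s')

  I2 : M2
  I2 = mat 1# 0# 0# 1#

  -- The matrix A_i from the pair (m_{2i+1}, m_{2i+2}); di = d^{-1}.
  Amat : (a a⁻ di : Carrier) → ℤ × ℤ → M2
  Amat a a⁻ di (p , q) =
    let d  = dval a a⁻
        X  = Xval a a⁻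
        Y  = Yval a a⁻
        x  = zpow X Y p
        xA = zpow a a⁻ p
        b  = zpow a⁻ a q
        y  = zpow Y X q in
    mat (x * b * d)            (x * (y - b) * di)
        ((x - xA) * b * d)     ((x - xA) * (y - b) * di + xA * y * d)

  -- A_1 A_2 ⋯ A_n
  Aprod : (a a⁻ di : Carrier) {n : ℕ} → Vec (ℤ × ℤ) n → M2
  Aprod a a⁻ di []       = I2
  Aprod a a⁻ di (p ∷ ps) = Amat a a⁻ di p ⊗ Aprod a a⁻ di ps

  -- d^{-n-2} X₀ᵀ (∏ A_i) J
  rhs : (a a⁻ di : Carrier) (n : ℕ) → ℤ → ℤ → Vec (ℤ × ℤ) n → Carrier
  rhs a a⁻ di n m₁ m₂ ms =
    let d   = dval a a⁻
        X   = Xval a a⁻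
        Y   = Yval a a⁻
        x₁  = zpow X Y m₁
        a₁  = zpow a a⁻ m₁
        b₂  = zpow a⁻ a m₂
        y₂  = zpow Y X m₂
        r₁  = (x₁ - a₁) * b₂ * (d * d)
        r₂  = a₁ * y₂ * (d * d) + (x₁ - a₁) * (y₂ - b₂)
        P   = Aprod a a⁻ di ms
        open M2 P
        w₁  = m11 + m12
        w₂  = m21 + m22 in
    pow di (n ℕ.+ 2) * (r₁ * w₁ + r₂ * w₂)

-- Expand Q[\widehat{VF_n}] by deletion and contraction, handling the chain v_{i-1} v_i and the sheaf
-- u v_i for i = 0, 1, …, n in turn (v_{-1} = u). What is left after each stage is the part of the graph
-- from v_i on, with v_i either apart from u or identified with u. A chain of length m contributes X^m
-- when one of its ends is free; between u and v_i it splits into (X^m - A^m)/d with v_i apart and A^m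
-- with v_i identified. A sheaf of width m splits into B^m (apart) and (Y^m - B^m)/d (identified), and
-- contributes Y^m when its ends are already identified. So the vector of the two values, scaled by
-- powers of d, is multiplied by A_i at stage i, and stage 0 gives X₀ᵀ = d (0, 1) A_0, where A_0 is
-- built from (m₁, m₂) like A_i from (m_{2i+1}, m_{2i+2}).

module Submission where

open import Defs
open import Level using (Level)
open import Data.Nat using (ℕ; _≤_)
open import Data.Integer using (ℤ; 0ℤ)
open import Data.Product using (_×_; proj₁; proj₂)
open import Data.Vec using (Vec)
open import Data.Vec.Relation.Unary.All using (All)
open import Relation.Binary.PropositionalEquality using (_≢_)
open import Algebra.Bundles using (CommutativeRing)

import Data.Nat as ℕ
import Data.Nat.Properties as ℕₚ
open import Data.Nat using (zero; suc; _∸_; _<_; _≟_; z≤n; s≤s)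
open import Data.Nat.Properties
  using (+-suc; +-cancelʳ-≡; ≤-refl; ≤-trans; <-trans; <⇒≤; <-≤-trans; ≤-<-trans;
         m≤m+n; n≤1+n; n<1+n; <-irrefl; >⇒≢; +-monoʳ-<; m≢1+m+n)
open import Data.Nat.Solver using (module +-*-Solver)
open import Data.Integer using (+_; -[1+_]; ∣_∣; sign)
open import Data.Sign using (Sign)
open import Data.Product using (_,_)
open import Data.Product.Function.NonDependent.Propositional using (_×-⇔_)
open import Data.Sum using (_⊎_; inj₁; inj₂)
open import Data.Sum.Function.Propositional using (_⊎-⇔_)
open import Data.Empty using (⊥-elim)
open import Data.Bool using (if_then_else_)
open import Data.List using (List; []; _∷_; _++_)
import Data.List.Relation.Unary.All as ListAll
open import Data.List.Relation.Unary.All using ([]; _∷_)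
open import Data.List.Relation.Unary.All.Properties using (++⁺)
open import Data.Vec using ([]; _∷_)
import Data.Vec.Relation.Unary.All as VecAll
open import Data.Vec.Relation.Unary.All using ([]; _∷_)
open import Function using (id; _∘_)
open import Function.Bundles using (_⇔_; mk⇔; Equivalence)
open import Function.Construct.Symmetry using (⇔-sym)
open import Function.Construct.Composition using (_⇔-∘_)
import Relation.Binary.PropositionalEquality as ≡
open import Relation.Binary.PropositionalEquality using (_≡_)
open import Relation.Nullary using (yes; no; does)
open import Relation.Nullary.Decidable using (dec-true; dec-false)
import Algebra.Properties.Ring as RingProperties
import Algebra.Properties.AbelianGroup as AbelianGroupProperties
import Algebra.Properties.CommutativeSemigroup as CommutativeSemigroupProperties
import Algebra.Solver.Ring.NaturalCoefficients.Default as NaturalCoefficientSolver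

-- Contracting the edge xy makes Qσ relabel its vertices by merge σ x y.

relabel : ℕ → ℕ → ℕ → ℕ
relabel a b v = if does (v ≟ b) then a else v

merge : (ℕ → ℕ) → ℕ → ℕ → ℕ → ℕ
merge σ x y = relabel (σ x) (σ y) ∘ σ

relabel-hit : ∀ {a b v} → v ≡ b → relabel a b v ≡ a
relabel-hit {b = b} {v} v≡b rewrite dec-true (v ≟ b) v≡b = ≡.refl

relabel-miss : ∀ {a b v} → v ≢ b → relabel a b v ≡ v
relabel-miss {b = b} {v} v≢b rewrite dec-false (v ≟ b) v≢b = ≡.refl

relabel-target : ∀ a b → relabel a b a ≡ a
relabel-target a b with a ≟ b
... | yes a≡b = relabel-hit a≡b
... | no a≢b = relabel-miss a≢b

relabel-trivial : ∀ a v → relabel a a v ≡ v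
relabel-trivial a v with v ≟ a
... | yes v≡a = ≡.trans (relabel-hit v≡a) (≡.sym v≡a)
... | no v≢a = relabel-miss v≢a

relabel-≡ : ∀ a b v v' →
  relabel a b v ≡ relabel a b v' ⇔ (v ≡ v' ⊎ (v ≡ a ⊎ v ≡ b) × (v' ≡ a ⊎ v' ≡ b))
relabel-≡ a b v v' = mk⇔ to from
  where
  to : relabel a b v ≡ relabel a b v' → v ≡ v' ⊎ (v ≡ a ⊎ v ≡ b) × (v' ≡ a ⊎ v' ≡ b)
  to e with v ≟ b | v' ≟ b
  ... | yes v≡b | yes v'≡b = inj₂ (inj₂ v≡b , inj₂ v'≡b)
  ... | yes v≡b | no v'≢b =
    inj₂ (inj₂ v≡b , inj₁ (≡.trans (≡.sym (relabel-miss v'≢b)) (≡.trans (≡.sym e) (relabel-hit v≡b))))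
  ... | no v≢b | yes v'≡b =
    inj₂ (inj₁ (≡.trans (≡.sym (relabel-miss v≢b)) (≡.trans e (relabel-hit v'≡b))) , inj₂ v'≡b)
  ... | no v≢b | no v'≢b = inj₁ (≡.trans (≡.sym (relabel-miss v≢b)) (≡.trans e (relabel-miss v'≢b)))

  to-a : ∀ {u} → u ≡ a ⊎ u ≡ b → relabel a b u ≡ a
  to-a (inj₁ ≡.refl) = relabel-target a b
  to-a (inj₂ u≡b) = relabel-hit u≡b

  from : v ≡ v' ⊎ (v ≡ a ⊎ v ≡ b) × (v' ≡ a ⊎ v' ≡ b) → relabel a b v ≡ relabel a b v'
  from (inj₁ v≡v') = ≡.cong (relabel a b) v≡v'
  from (inj₂ (near , near')) = ≡.trans (to-a near) (≡.sym (to-a near'))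

merge-joins : ∀ σ x y → merge σ x y x ≡ merge σ x y y
merge-joins σ x y =
  Equivalence.from (relabel-≡ (σ x) (σ y) (σ x) (σ y)) (inj₂ (inj₁ ≡.refl , inj₂ ≡.refl))

merge-hit : ∀ σ x y → merge σ x y y ≡ σ x
merge-hit σ x y = relabel-hit {σ x} {σ y} ≡.refl

merge-cong : ∀ {σ τ x y x' y' w} → σ x ≡ τ x' → σ y ≡ τ y' → σ w ≡ τ w →
  merge σ x y w ≡ merge τ x' y' w
merge-cong {σ} {w = w} ex ey ew =
  ≡.trans (≡.cong₂ (λ a b → relabel a b (σ w)) ex ey) (≡.cong (relabel _ _) ew)

record Agree (S : ℕ → Set) (σ τ : ℕ → ℕ) : Set where
  constructor agree
  field same-class : ∀ {w w'} → S w → S w' → (σ w ≡ σ w') ⇔ (τ w ≡ τ w')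
open Agree

agree-trans : ∀ {S σ τ ρ} → Agree S σ τ → Agree S τ ρ → Agree S σ ρ
agree-trans A B = agree λ sw sw' → same-class B sw sw' ⇔-∘ same-class A sw sw'

agree-pointwise : ∀ {S σ τ} → (∀ {w} → S w → σ w ≡ τ w) → Agree S σ τ
agree-pointwise h = agree λ sw sw' →
  mk⇔ (λ e → ≡.trans (≡.sym (h sw)) (≡.trans e (h sw')))
      (λ e → ≡.trans (h sw) (≡.trans e (≡.sym (h sw'))))

agree-refl : ∀ {S σ} → Agree S σ σ
agree-refl = agree-pointwise λ _ → ≡.refl

merge-resp : ∀ {S σ τ x y} → Agree S σ τ → S x → S y → Agree S (merge σ x y) (merge τ x y)
merge-resp {S} {σ} {τ} {x} {y} A sx sy = agree λ {w} {w'} sw sw' →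
  ⇔-sym (relabel-≡ (τ x) (τ y) (τ w) (τ w'))
    ⇔-∘ ((same-class A sw sw' ⊎-⇔ (near sw ×-⇔ near sw')) ⇔-∘ relabel-≡ (σ x) (σ y) (σ w) (σ w'))
  where
  near : ∀ {v} → S v → (σ v ≡ σ x ⊎ σ v ≡ σ y) ⇔ (τ v ≡ τ x ⊎ τ v ≡ τ y)
  near sv = same-class A sv sx ⊎-⇔ same-class A sv sy

merge-isolated : ∀ {S σ z y} → (∀ {w} → S w → σ w ≢ σ z) → Agree S (merge σ z y) σ
merge-isolated {S} {σ} {z} {y} isolated = agree λ {w} {w'} sw sw' →
  mk⇔ (split sw sw' ∘ Equivalence.to (relabel-≡ (σ z) (σ y) (σ w) (σ w')))
      (Equivalence.from (relabel-≡ (σ z) (σ y) (σ w) (σ w')) ∘ inj₁)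
  where
  split : ∀ {w w'} → S w → S w' →
    σ w ≡ σ w' ⊎ (σ w ≡ σ z ⊎ σ w ≡ σ y) × (σ w' ≡ σ z ⊎ σ w' ≡ σ y) → σ w ≡ σ w'
  split _ _ (inj₁ e) = e
  split sw _ (inj₂ (inj₁ e , _)) = ⊥-elim (isolated sw e)
  split _ sw' (inj₂ (_ , inj₁ e)) = ⊥-elim (isolated sw' e)
  split _ _ (inj₂ (inj₂ e , inj₂ e')) = ≡.trans e (≡.sym e')

Covers : (ℕ → Set) → List Edge → Set
Covers S = ListAll.All (λ e → S (proj₁ e) × S (proj₁ (proj₂ e)))

covers-mono : ∀ {S S'} → (∀ {w} → S w → S' w) → ∀ {es} → Covers S es → Covers S' es
covers-mono h = ListAll.map (λ (sx , sy) → h sx , h sy)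

record Fixes (σ : ℕ → ℕ) (f m : ℕ) : Set where
  constructor fixing
  field fixed : ∀ {j} → j < m → σ (f ℕ.+ j) ≡ f ℕ.+ j
open Fixes

record Outside (f m v : ℕ) : Set where
  constructor outside
  field avoids : ∀ {j} → j < m → v ≢ f ℕ.+ j
open Outside

fixes-head : ∀ {σ f m} → Fixes σ f (suc m) → σ f ≡ f
fixes-head {σ} {f} fix = ≡.subst (λ v → σ v ≡ v) (ℕₚ.+-identityʳ f) (fixed fix (s≤s z≤n))

fixes-tail : ∀ {σ f m} → Fixes σ f (suc m) → Fixes σ (suc f) m
fixes-tail {σ} {f} fix = fixing λ j<m → ≡.subst (λ v → σ v ≡ v) (+-suc f _) (fixed fix (s≤s j<m))

outside-head : ∀ {f m v} → Outside f (suc m) v → v ≢ f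
outside-head {f} out e = avoids out (s≤s z≤n) (≡.trans e (≡.sym (ℕₚ.+-identityʳ f)))

outside-tail : ∀ {f m v} → Outside f (suc m) v → Outside (suc f) m v
outside-tail {f} out = outside λ j<m e → avoids out (s≤s j<m) (≡.trans e (≡.sym (+-suc f _)))

below-outside : ∀ {f m v} → v < f → Outside f m v
below-outside {f} v<f = outside λ {j} _ e → <-irrefl e (<-≤-trans v<f (m≤m+n f j))

outside-fresh : ∀ {σ f m v} → Fixes σ f (suc m) → Outside f (suc m) v → v ≢ σ f
outside-fresh fix out e = outside-head out (≡.trans e (fixes-head fix))

fresh-outside : ∀ {σ f m} → Fixes σ f (suc m) → Outside (suc f) m (σ f)
fresh-outside {f = f} fix = outside λ _ e → m≢1+m+n f (≡.trans (≡.sym (fixes-head fix)) e)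

merge-fixes : ∀ {σ x f m} → Fixes σ f (suc m) → Fixes (merge σ x f) (suc f) m
merge-fixes {f = f} fix = fixing λ j<m →
  ≡.trans (relabel-miss λ e →
             m≢1+m+n f (≡.sym (≡.trans (≡.sym (fixed (fixes-tail fix) j<m)) (≡.trans e (fixes-head fix)))))
          (fixed (fixes-tail fix) j<m)

record FreshChain (S : ℕ → Set) (σ : ℕ → ℕ) (z f m : ℕ) : Set where
  constructor fresh-chain
  field
    fixes-internal : Fixes σ f m
    outside-rest : ∀ {w} → S w → Outside f m (σ w)
    outside-start : Outside f m (σ z)

module _ {S σ z f m} (F : FreshChain S σ z f (suc m)) where
  open FreshChain F

  start≢next : σ z ≢ σ f
  start≢next = outside-fresh fixes-internal outside-start

  rest≢next : ∀ {w} → S w → σ w ≢ σ f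
  rest≢next = outside-fresh fixes-internal ∘ outside-rest

  contraction-keeps : ∀ {w} → S w → merge σ z f w ≡ σ w
  contraction-keeps = relabel-miss ∘ rest≢next

  fresh-after-deletion : FreshChain S σ f (suc f) m
  fresh-after-deletion =
    fresh-chain (fixes-tail fixes-internal) (outside-tail ∘ outside-rest) (fresh-outside fixes-internal)

  fresh-after-contraction : FreshChain S (merge σ z f) f (suc f) m
  fresh-after-contraction = fresh-chain
    (merge-fixes fixes-internal)
    (λ sw → ≡.subst (Outside (suc f) m) (≡.sym (contraction-keeps sw)) (outside-tail (outside-rest sw)))
    (≡.subst (Outside (suc f) m) (≡.sym (merge-hit σ z f)) (outside-tail outside-start))

chain-covers : ∀ {S} x y s m f → S x → S y → (∀ {w} → f ≤ w → S w) → Covers S (chain x y s m f)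
chain-covers x y s zero f _ _ _ = []
chain-covers x y s (suc zero) f sx sy _ = (sx , sy) ∷ []
chain-covers x y s (suc (suc m)) f sx sy fresh =
  (sx , fresh ≤-refl) ∷ chain-covers f y s (suc m) (suc f) (fresh ≤-refl) sy (fresh ∘ <⇒≤)

sheaf-covers : ∀ {S} x y s m → S x → S y → Covers S (sheaf x y s m)
sheaf-covers x y s zero _ _ = []
sheaf-covers x y s (suc m) sx sy = (sx , sy) ∷ sheaf-covers x y s m sx sy

module DeletionContraction {c ℓ} (R : CommutativeRing c ℓ) (α β δ : CommutativeRing.Carrier R) where
  open CommutativeRing R renaming (refl to ≈-refl; sym to ≈-sym; trans to ≈-trans)
  open WithRing R using (Qσ; Q; pow)
  open CommutativeSemigroupProperties *-commutativeSemigroup using (x∙yz≈y∙xz)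
  open NaturalCoefficientSolver commutativeSemiring using (solve; _:+_; _:*_; _:=_; con)
  open import Relation.Binary.Reasoning.Setoid setoid

  deletion contraction loop pendant : Sign → Carrier
  deletion Sign.+ = β
  deletion Sign.- = α
  contraction Sign.+ = α
  contraction Sign.- = β
  loop Sign.+ = α * δ + β
  loop Sign.- = α + β * δ
  pendant s = deletion s * δ + contraction s

  loop≈ : ∀ s → loop s ≈ contraction s * δ + deletion s
  loop≈ Sign.+ = ≈-refl
  loop≈ Sign.- = +-comm _ _

  -- Opaque, so that unification treats 𝒬 k σ es as rigid instead of unfolding Qσ.
  opaque
    𝒬 : ℕ → (ℕ → ℕ) → List Edge → Carrier
    𝒬 = Qσ α β δ

  opaque
    unfolding 𝒬

    𝒬-empty : ∀ {k σ} → 𝒬 k σ [] ≡ pow δ (k ∸ 1)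
    𝒬-empty = ≡.refl

    𝒬-nonloop : ∀ {k σ x y s} es → σ x ≢ σ y →
      𝒬 k σ ((x , y , s) ∷ es) ≡ deletion s * 𝒬 k σ es + contraction s * 𝒬 (k ∸ 1) (merge σ x y) es
    𝒬-nonloop {σ = σ} {x} {y} {Sign.+} es σx≢σy rewrite dec-false (σ x ≟ σ y) σx≢σy = ≡.refl
    𝒬-nonloop {σ = σ} {x} {y} {Sign.-} es σx≢σy rewrite dec-false (σ x ≟ σ y) σx≢σy = ≡.refl

    𝒬-loop : ∀ {k σ x y s} es → σ x ≡ σ y → 𝒬 k σ ((x , y , s) ∷ es) ≡ loop s * 𝒬 k σ es
    𝒬-loop {σ = σ} {x} {y} {Sign.+} es σx≡σy rewrite dec-true (σ x ≟ σ y) σx≡σy = ≡.refl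
    𝒬-loop {σ = σ} {x} {y} {Sign.-} es σx≡σy rewrite dec-true (σ x ≟ σ y) σx≡σy = ≡.refl

    Q≡𝒬 : ∀ es k → Q α β δ (es , k) ≡ 𝒬 k id es
    Q≡𝒬 es k = ≡.refl

  -- sheafCoeff s m = (loop s ^ m - deletion s ^ m) / δ and
  -- chainCoeff s m = (pendant s ^ m - contraction s ^ m) / δ.

  sheafCoeff chainCoeff : Sign → ℕ → Carrier
  sheafCoeff s zero = 0#
  sheafCoeff s (suc m) = deletion s * sheafCoeff s m + contraction s * pow (loop s) m
  chainCoeff s zero = 0#
  chainCoeff s (suc m) = deletion s * pow (pendant s) m + contraction s * chainCoeff s m

  expansion-step : ∀ u w {P C X} → P ≈ C * δ + X → (u * δ + w) * P ≈ (u * P + w * C) * δ + w * X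
  expansion-step u w {P} {C} {X} P≈ = begin
    (u * δ + w) * P             ≈⟨ *-congˡ P≈ ⟩
    (u * δ + w) * (C * δ + X)   ≈⟨ solve 5 (λ u w δ C X → (u :* δ :+ w) :* (C :* δ :+ X)
                                       := (u :* (C :* δ :+ X) :+ w :* C) :* δ :+ w :* X) ≈-refl u w δ C X ⟩
    (u * (C * δ + X) + w * C) * δ + w * X ≈⟨ +-congʳ (*-congʳ (+-congʳ (*-congˡ P≈))) ⟨
    (u * P + w * C) * δ + w * X ∎

  pow-pendant : ∀ s m → pow (pendant s) m ≈ chainCoeff s m * δ + pow (contraction s) m
  pow-pendant s zero = solve 1 (λ δ → con 1 := con 0 :* δ :+ con 1) ≈-refl δ
  pow-pendant s (suc m) = expansion-step (deletion s) (contraction s) (pow-pendant s m)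

  pow-loop : ∀ s m → pow (loop s) m ≈ sheafCoeff s m * δ + pow (deletion s) m
  pow-loop s zero = solve 1 (λ δ → con 1 := con 0 :* δ :+ con 1) ≈-refl δ
  pow-loop s (suc m) = ≈-trans (*-congʳ (loop≈ s))
    (≈-trans (expansion-step (contraction s) (deletion s) (pow-loop s m))
             (+-congʳ (*-congʳ (+-comm _ _))))

  𝒬-resp : ∀ {S σ τ} k es → Covers S es → Agree S σ τ → 𝒬 k σ es ≈ 𝒬 k τ es
  𝒬-resp k [] _ _ = reflexive (≡.trans 𝒬-empty (≡.sym 𝒬-empty))
  𝒬-resp {S} {σ} {τ} k ((x , y , s) ∷ es) ((sx , sy) ∷ cov) A with σ x ≟ σ y
  ... | yes σx≡σy = begin
    𝒬 k σ ((x , y , s) ∷ es) ≡⟨ 𝒬-loop es σx≡σy ⟩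
    loop s * 𝒬 k σ es        ≈⟨ *-congˡ (𝒬-resp k es cov A) ⟩
    loop s * 𝒬 k τ es        ≡⟨ 𝒬-loop es (Equivalence.to (same-class A sx sy) σx≡σy) ⟨
    𝒬 k τ ((x , y , s) ∷ es) ∎
  ... | no σx≢σy = begin
    𝒬 k σ ((x , y , s) ∷ es)
      ≡⟨ 𝒬-nonloop es σx≢σy ⟩
    deletion s * 𝒬 k σ es + contraction s * 𝒬 (k ∸ 1) (merge σ x y) es
      ≈⟨ +-cong (*-congˡ (𝒬-resp k es cov A)) (*-congˡ (𝒬-resp (k ∸ 1) es cov (merge-resp A sx sy))) ⟩
    deletion s * 𝒬 k τ es + contraction s * 𝒬 (k ∸ 1) (merge τ x y) es
      ≡⟨ 𝒬-nonloop es (σx≢σy ∘ Equivalence.from (same-class A sx sy)) ⟨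
    𝒬 k τ ((x , y , s) ∷ es) ∎

  -- V is the value of es on k vertices identified as by σ, for every relabelling that partitions S
  -- like σ does, up to the factor δ ^ t contributed by t further isolated vertices.

  record Value (S : ℕ → Set) (es : List Edge) (k : ℕ) (σ : ℕ → ℕ) (V : Carrier) : Set ℓ where
    constructor value
    field evaluate : ∀ {τ} → Agree S τ σ → ∀ t → 𝒬 (k ℕ.+ t) τ es ≈ pow δ t * V
  open Value

  value-intro : ∀ {S es k σ V} → Covers S es → (∀ t → 𝒬 (k ℕ.+ t) σ es ≈ pow δ t * V) →
    Value S es k σ V
  value-intro cov h = value λ A t → ≈-trans (𝒬-resp _ _ cov A) (h t)

  evaluate-suc : ∀ {S es k σ τ V} → Value S es k σ V → Agree S τ σ → ∀ t →
    𝒬 (suc (k ℕ.+ t)) τ es ≈ δ * pow δ t * V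
  evaluate-suc {es = es} {k} {τ = τ} val A t =
    ≈-trans (reflexive (≡.cong (λ n → 𝒬 n τ es) (≡.sym (+-suc k t)))) (evaluate val A (suc t))

  value-resp : ∀ {S es k σ σ' V} → Agree S σ' σ → Value S es k σ V → Value S es k σ' V
  value-resp B val = value λ A → evaluate val (agree-trans A B)

  factor : ∀ u v w x y → u * (w * x) + v * (w * y) ≈ w * (u * x + v * y)
  factor = solve 5 (λ u v w x y → u :* (w :* x) :+ v :* (w :* y) := w :* (u :* x :+ v :* y)) ≈-refl

  𝒬-sheaf-loop : ∀ {k σ x y} s m es → σ x ≡ σ y →
    𝒬 k σ (sheaf x y s m ++ es) ≈ pow (loop s) m * 𝒬 k σ es
  𝒬-sheaf-loop s zero es _ = ≈-sym (*-identityˡ _)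
  𝒬-sheaf-loop {k} {σ} {x} {y} s (suc m) es σx≡σy = begin
    𝒬 k σ ((x , y , s) ∷ sheaf x y s m ++ es) ≡⟨ 𝒬-loop _ σx≡σy ⟩
    loop s * 𝒬 k σ (sheaf x y s m ++ es)     ≈⟨ *-congˡ (𝒬-sheaf-loop s m es σx≡σy) ⟩
    loop s * (pow (loop s) m * 𝒬 k σ es)    ≈⟨ *-assoc _ _ _ ⟨
    pow (loop s) (suc m) * 𝒬 k σ es ∎

  𝒬-sheaf : ∀ {k σ x y} s m es → σ x ≢ σ y →
    𝒬 k σ (sheaf x y s m ++ es)
      ≈ pow (deletion s) m * 𝒬 k σ es + sheafCoeff s m * 𝒬 (k ∸ 1) (merge σ x y) es
  𝒬-sheaf s zero es _ = solve 2 (λ Q Q' → Q := con 1 :* Q :+ con 0 :* Q') ≈-refl _ _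
  𝒬-sheaf {k} {σ} {x} {y} s (suc m) es σx≢σy = begin
    𝒬 k σ ((x , y , s) ∷ sheaf x y s m ++ es)
      ≡⟨ 𝒬-nonloop _ σx≢σy ⟩
    deletion s * 𝒬 k σ (sheaf x y s m ++ es) + contraction s * 𝒬 (k ∸ 1) σ' (sheaf x y s m ++ es)
      ≈⟨ +-cong (*-congˡ (𝒬-sheaf s m es σx≢σy)) (*-congˡ (𝒬-sheaf-loop s m es (merge-joins σ x y))) ⟩
    deletion s * (pow (deletion s) m * 𝒬 k σ es + sheafCoeff s m * 𝒬 (k ∸ 1) σ' es)
      + contraction s * (pow (loop s) m * 𝒬 (k ∸ 1) σ' es)
      ≈⟨ solve 7 (λ dl ct Dm T L Q Q' → dl :* (Dm :* Q :+ T :* Q') :+ ct :* (L :* Q')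
                    := (dl :* Dm) :* Q :+ (dl :* T :+ ct :* L) :* Q') ≈-refl _ _ _ _ _ _ _ ⟩
    pow (deletion s) (suc m) * 𝒬 k σ es + sheafCoeff s (suc m) * 𝒬 (k ∸ 1) σ' es ∎
    where
    σ' = merge σ x y

  sheaf-loop-value : ∀ {S es k σ x y V} s m → S x → S y → σ x ≡ σ y →
    Value S es k σ V → Value S (sheaf x y s m ++ es) k σ (pow (loop s) m * V)
  sheaf-loop-value s m sx sy σx≡σy val = value λ A t →
    ≈-trans (𝒬-sheaf-loop s m _ (Equivalence.from (same-class A sx sy) σx≡σy))
            (≈-trans (*-congˡ (evaluate val A t)) (x∙yz≈y∙xz _ _ _))

  sheaf-value : ∀ {S es k σ x y V V'} s m → S x → S y → σ x ≢ σ y →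
    Value S es (suc k) σ V → Value S es k (merge σ x y) V' →
    Value S (sheaf x y s m ++ es) (suc k) σ (pow (deletion s) m * V + sheafCoeff s m * V')
  sheaf-value s m sx sy σx≢σy val val' = value λ A t →
    ≈-trans (𝒬-sheaf s m _ (σx≢σy ∘ Equivalence.to (same-class A sx sy)))
      (≈-trans (+-cong (*-congˡ (evaluate val A t)) (*-congˡ (evaluate val' (merge-resp A sx sy) t)))
               (factor _ _ _ _ _))

  pendant-chain : ∀ {S es k V} s m z y f σ → FreshChain S σ z f m →
    (∀ {w} → S w → σ w ≢ σ z) → S y → Value S es k σ V →
    ∀ t → 𝒬 (suc m ℕ.+ k ℕ.+ t) σ (chain z y s (suc m) f ++ es) ≈ pow δ t * (pow (pendant s) (suc m) * V)
  pendant-chain {S} {es} {k} {V} s zero z y f σ _ isolated sy val t = begin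
    𝒬 (suc k ℕ.+ t) σ ((z , y , s) ∷ es)
      ≡⟨ 𝒬-nonloop es (isolated sy ∘ ≡.sym) ⟩
    deletion s * 𝒬 (suc (k ℕ.+ t)) σ es + contraction s * 𝒬 (k ℕ.+ t) (merge σ z y) es
      ≈⟨ +-cong (*-congˡ (evaluate-suc val agree-refl t)) (*-congˡ (evaluate val (merge-isolated isolated) t)) ⟩
    deletion s * (δ * pow δ t * V) + contraction s * (pow δ t * V)
      ≈⟨ solve 5 (λ dl ct δ δt V → dl :* (δ :* δt :* V) :+ ct :* (δt :* V)
                    := δt :* (((dl :* δ :+ ct) :* con 1) :* V)) ≈-refl _ _ δ _ V ⟩
    pow δ t * (pow (pendant s) 1 * V) ∎
  pendant-chain {S} {es} {k} {V} s (suc m) z y f σ F isolated sy val t = begin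
    𝒬 (suc (suc m) ℕ.+ k ℕ.+ t) σ ((z , f , s) ∷ rest)
      ≡⟨ 𝒬-nonloop rest (start≢next F) ⟩
    deletion s * 𝒬 (suc (suc m ℕ.+ k ℕ.+ t)) σ rest + contraction s * 𝒬 (suc m ℕ.+ k ℕ.+ t) σ' rest
      ≈⟨ +-cong (*-congˡ deleted) (*-congˡ contracted) ⟩
    deletion s * (δ * pow δ t * P) + contraction s * (pow δ t * P)
      ≈⟨ solve 5 (λ dl ct δ δt P → dl :* (δ :* δt :* P) :+ ct :* (δt :* P)
                    := δt :* ((dl :* δ :+ ct) :* P)) ≈-refl _ _ δ _ P ⟩
    pow δ t * (pendant s * P)
      ≈⟨ *-congˡ (*-assoc _ _ _) ⟨
    pow δ t * (pow (pendant s) (suc (suc m)) * V) ∎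
    where
    rest : List Edge
    rest = chain f y s (suc m) (suc f) ++ es
    σ' : ℕ → ℕ
    σ' = merge σ z f
    P : Carrier
    P = pow (pendant s) (suc m) * V
    deleted : 𝒬 (suc (suc m ℕ.+ k ℕ.+ t)) σ rest ≈ δ * pow δ t * P
    deleted = ≈-trans (reflexive (≡.cong (λ n → 𝒬 n σ rest) (≡.sym (+-suc (suc m ℕ.+ k) t))))
                (pendant-chain s m f y (suc f) σ (fresh-after-deletion F) (rest≢next F) sy val (suc t))
    contracted : 𝒬 (suc m ℕ.+ k ℕ.+ t) σ' rest ≈ pow δ t * P
    contracted = pendant-chain s m f y (suc f) σ' (fresh-after-contraction F)
                   (λ sw e → isolated sw
                      (≡.trans (≡.sym (contraction-keeps F sw)) (≡.trans e (merge-hit σ z f))))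
                   sy (value-resp (agree-pointwise (contraction-keeps F)) val) t

  chain-value : ∀ {S es k D C} s m x y f σ → FreshChain S σ x f m →
    σ x ≢ σ y → S y → Value S es (suc k) σ D → Value S es k (merge σ x y) C →
    ∀ t → 𝒬 (m ℕ.+ suc k ℕ.+ t) σ (chain x y s (suc m) f ++ es)
            ≈ pow δ t * (chainCoeff s (suc m) * D + pow (contraction s) (suc m) * C)
  chain-value {S} {es} {k} {D} {C} s zero x y f σ _ σx≢σy _ valD valC t = begin
    𝒬 (suc k ℕ.+ t) σ ((x , y , s) ∷ es)
      ≡⟨ 𝒬-nonloop es σx≢σy ⟩
    deletion s * 𝒬 (suc k ℕ.+ t) σ es + contraction s * 𝒬 (k ℕ.+ t) (merge σ x y) es
      ≈⟨ +-cong (*-congˡ (evaluate valD agree-refl t)) (*-congˡ (evaluate valC agree-refl t)) ⟩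
    deletion s * (pow δ t * D) + contraction s * (pow δ t * C)
      ≈⟨ solve 5 (λ dl ct δt D C → dl :* (δt :* D) :+ ct :* (δt :* C)
                    := δt :* ((dl :* con 1 :+ ct :* con 0) :* D :+ (ct :* con 1) :* C)) ≈-refl _ _ _ D C ⟩
    pow δ t * (chainCoeff s 1 * D + pow (contraction s) 1 * C) ∎
  chain-value {S} {es} {k} {D} {C} s (suc m) x y f σ F σx≢σy sy valD valC t = begin
    𝒬 (suc m ℕ.+ suc k ℕ.+ t) σ ((x , f , s) ∷ rest)
      ≡⟨ 𝒬-nonloop rest (start≢next F) ⟩
    deletion s * 𝒬 (suc m ℕ.+ suc k ℕ.+ t) σ rest + contraction s * 𝒬 (m ℕ.+ suc k ℕ.+ t) σ' rest
      ≈⟨ +-cong (*-congˡ deleted) (*-congˡ contracted) ⟩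
    deletion s * (pow δ t * (Pm * D)) + contraction s * (pow δ t * (Cm * D + Km * C))
      ≈⟨ solve 8 (λ dl ct δt Pm Cm Km D C → dl :* (δt :* (Pm :* D)) :+ ct :* (δt :* (Cm :* D :+ Km :* C))
                    := δt :* ((dl :* Pm :+ ct :* Cm) :* D :+ (ct :* Km) :* C)) ≈-refl _ _ _ Pm Cm Km D C ⟩
    pow δ t * (chainCoeff s (suc (suc m)) * D + pow (contraction s) (suc (suc m)) * C) ∎
    where
    rest : List Edge
    rest = chain f y s (suc m) (suc f) ++ es
    σ' : ℕ → ℕ
    σ' = merge σ x f
    Pm Cm Km : Carrier
    Pm = pow (pendant s) (suc m)
    Cm = chainCoeff s (suc m)
    Km = pow (contraction s) (suc m)
    kept : ∀ {w} → S w → σ' w ≡ σ w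
    kept = contraction-keeps F
    merged : ∀ {w} → S w → merge σ' f y w ≡ merge σ x y w
    merged sw = merge-cong {σ = σ'} {τ = σ} (merge-hit σ x f) (kept sy) (kept sw)
    deleted : 𝒬 (suc m ℕ.+ suc k ℕ.+ t) σ rest ≈ pow δ t * (Pm * D)
    deleted = pendant-chain s m f y (suc f) σ (fresh-after-deletion F) (rest≢next F) sy valD t
    contracted : 𝒬 (m ℕ.+ suc k ℕ.+ t) σ' rest ≈ pow δ t * (Cm * D + Km * C)
    contracted = chain-value s m f y (suc f) σ' (fresh-after-contraction F)
                   (λ e → σx≢σy (≡.trans (≡.sym (merge-hit σ x f)) (≡.trans e (kept sy))))
                   sy (value-resp (agree-pointwise kept) valD) (value-resp (agree-pointwise merged) valC) t

-- tailEdges i f ps is the part of \widehat{VF_n} from vertex i on (vertex i is v_{i-1}, or u for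
-- i = 0); Tail N i f contains its vertices, and tailSize ps counts them when vertex i is u.

tailEdges : ∀ {L} → ℕ → ℕ → Vec (ℤ × ℤ) L → List Edge
tailEdges i f ps = proj₁ (vfRest i f (vecToList ps))

Tail : ℕ → ℕ → ℕ → ℕ → Set
Tail N i f w = w ≡ 0 ⊎ (i ≤ w × w ≤ N) ⊎ f ≤ w

tailSize : ∀ {L} → Vec (ℤ × ℤ) L → ℕ
tailSize [] = 1
tailSize ((p , _) ∷ ps) = (∣ p ∣ ∸ 1) ℕ.+ suc (tailSize ps)

tail-covers : ∀ {L N} i f (ps : Vec (ℤ × ℤ) L) → i ℕ.+ L ≤ N → Covers (Tail N i f) (tailEdges i f ps)
tail-covers i f [] _ = []
tail-covers {suc L} {N} i f ((p , q) ∷ ps) i+L≤N =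
  ++⁺ (chain-covers i (suc i) (sign p) ∣ p ∣ f v-i v-next (inj₂ ∘ inj₂))
      (++⁺ (sheaf-covers 0 (suc i) (sign q) ∣ q ∣ (inj₁ ≡.refl) v-next)
           (covers-mono shrink (tail-covers (suc i) (f ℕ.+ (∣ p ∣ ∸ 1)) ps 1+i+L≤N)))
  where
  1+i+L≤N : suc i ℕ.+ L ≤ N
  1+i+L≤N = ≡.subst (_≤ N) (+-suc i L) i+L≤N
  1+i≤N : suc i ≤ N
  1+i≤N = ≤-trans (m≤m+n (suc i) L) 1+i+L≤N
  v-i : Tail N i f i
  v-i = inj₂ (inj₁ (≤-refl , <⇒≤ 1+i≤N))
  v-next : Tail N i f (suc i)
  v-next = inj₂ (inj₁ (n≤1+n i , 1+i≤N))
  shrink : ∀ {w} → Tail N (suc i) (f ℕ.+ (∣ p ∣ ∸ 1)) w → Tail N i f w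
  shrink (inj₁ w≡0) = inj₁ w≡0
  shrink (inj₂ (inj₁ (i<w , w≤N))) = inj₂ (inj₁ (<⇒≤ i<w , w≤N))
  shrink (inj₂ (inj₂ f'≤w)) = inj₂ (inj₂ (≤-trans (m≤m+n f _) f'≤w))

tail-vertices : ∀ {L} i f (ps : Vec (ℤ × ℤ) L) →
  tailSize ps ℕ.+ f ≡ proj₂ (vfRest i f (vecToList ps)) ℕ.+ suc L
tail-vertices i f [] = ℕₚ.+-comm 1 f
tail-vertices {suc L} i f ((p , _) ∷ ps) =
  ≡.trans (rearrange (∣ p ∣ ∸ 1) (tailSize ps) f)
    (≡.trans (≡.cong suc (tail-vertices (suc i) (f ℕ.+ (∣ p ∣ ∸ 1)) ps)) (≡.sym (+-suc _ (suc L))))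
  where
  open +-*-Solver
  rearrange : ∀ k K f → k ℕ.+ suc K ℕ.+ f ≡ suc (K ℕ.+ (f ℕ.+ k))
  rearrange = solve 3 (λ k K f → k :+ (con 1 :+ K) :+ f := con 1 :+ (K :+ (f :+ k))) ≡.refl

sheafEdges : ∀ {L} → ℕ → ℕ → ℕ → ℤ → Vec (ℤ × ℤ) L → List Edge
sheafEdges i f k q ps = sheaf 0 (suc i) (sign q) ∣ q ∣ ++ tailEdges (suc i) (f ℕ.+ k) ps

stepEdges : ∀ {L} → ℕ → ℕ → Sign → ℕ → ℤ → Vec (ℤ × ℤ) L → List Edge
stepEdges i f s k q ps = chain i (suc i) s (suc k) f ++ sheafEdges i f k q ps

joinedAt : ℕ → ℕ → ℕ
joinedAt i = merge id 0 i

module _ {N i f k : ℕ} (i<f : i < f) where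

  tail-≢ : ∀ {w} → Tail N (suc i) (f ℕ.+ k) w → w ≡ 0 ⊎ w ≢ i
  tail-≢ (inj₁ w≡0) = inj₁ w≡0
  tail-≢ (inj₂ (inj₁ (i<w , _))) = inj₂ (>⇒≢ i<w)
  tail-≢ (inj₂ (inj₂ f+k≤w)) = inj₂ (>⇒≢ (<-≤-trans i<f (≤-trans (m≤m+n f k) f+k≤w)))

  joinedAt-tail : ∀ {w} → Tail N (suc i) (f ℕ.+ k) w → joinedAt i w ≡ w
  joinedAt-tail sw with tail-≢ sw
  ... | inj₁ ≡.refl = relabel-target 0 i
  ... | inj₂ w≢i = relabel-miss w≢i

tail-outside : ∀ {N j f k w} → N < f → Tail N j (f ℕ.+ k) w → Outside f k w
tail-outside N<f (inj₁ ≡.refl) = below-outside (≤-<-trans z≤n N<f)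
tail-outside N<f (inj₂ (inj₁ (_ , w≤N))) = below-outside (≤-<-trans w≤N N<f)
tail-outside {f = f} N<f (inj₂ (inj₂ f+k≤w)) =
  outside λ j<k e → <-irrefl (≡.sym e) (<-≤-trans (+-monoʳ-< f j<k) f+k≤w)

module VFhatExpansion {c ℓ} (R : CommutativeRing c ℓ) (α β δ : CommutativeRing.Carrier R) where
  open CommutativeRing R renaming (refl to ≈-refl; sym to ≈-sym; trans to ≈-trans)
  open WithRing R using (Q; pow)
  open DeletionContraction R α β δ
  open Value
  open import Relation.Binary.Reasoning.Setoid setoid

  tailApart tailJoined : ∀ {L} → Vec (ℤ × ℤ) L → Carrier
  tailSheaf : ∀ {L} → ℤ → Vec (ℤ × ℤ) L → Carrier
  tailSheaf q ps = pow (deletion (sign q)) ∣ q ∣ * tailApart ps + sheafCoeff (sign q) ∣ q ∣ * tailJoined ps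
  tailApart [] = δ
  tailApart ((p , q) ∷ ps) = pow (pendant (sign p)) ∣ p ∣ * tailSheaf q ps
  tailJoined [] = 1#
  tailJoined ((p , q) ∷ ps) =
    chainCoeff (sign p) ∣ p ∣ * tailSheaf q ps
      + pow (contraction (sign p)) ∣ p ∣ * (pow (loop (sign q)) ∣ q ∣ * tailJoined ps)

  -- Kept apart from u, vertex i is the free end of a pendant chain; vertex 0 is u itself.

  TailValues : (ℕ → Set) → List Edge → ℕ → ℕ → Carrier → Carrier → Set ℓ
  TailValues S es i k Vapart Vjoined =
    (1 ≤ i → Value S es (suc k) id Vapart) × Value S es k (joinedAt i) Vjoined

  module TailStep {L N i f} s k q (ps : Vec (ℤ × ℤ) L) (i<N : suc i ≤ N) (N<f : N < f)
    (cov : Covers (Tail N i f) (stepEdges i f s k q ps))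
    (rest : TailValues (Tail N (suc i) (f ℕ.+ k)) (tailEdges (suc i) (f ℕ.+ k) ps) (suc i) (tailSize ps)
                       (tailApart ps) (tailJoined ps)) where

    S : ℕ → Set
    S = Tail N (suc i) (f ℕ.+ k)
    i<f : i < f
    i<f = <-trans i<N N<f

    v-next : S (suc i)
    v-next = inj₂ (inj₁ (≤-refl , i<N))

    sheafApart : Value S (sheafEdges i f k q ps) (suc (tailSize ps)) id (tailSheaf q ps)
    sheafApart = sheaf-value (sign q) ∣ q ∣ (inj₁ ≡.refl) v-next (λ ()) (proj₁ rest (s≤s z≤n)) (proj₂ rest)

    sheafJoined : Value S (sheafEdges i f k q ps) (tailSize ps) (joinedAt (suc i))
                    (pow (loop (sign q)) ∣ q ∣ * tailJoined ps)
    sheafJoined = sheaf-loop-value (sign q) ∣ q ∣ (inj₁ ≡.refl) v-next (merge-joins id 0 (suc i)) (proj₂ rest)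

    apart : 1 ≤ i → Value (Tail N i f) (stepEdges i f s k q ps) (suc (k ℕ.+ suc (tailSize ps))) id
                       (pow (pendant s) (suc k) * tailSheaf q ps)
    apart 1≤i = value-intro cov (pendant-chain s k i (suc i) f id
                                   (fresh-chain (fixing λ _ → ≡.refl) (tail-outside N<f) (below-outside i<f))
                                   isolated v-next sheafApart)
      where
      isolated : ∀ {w} → S w → w ≢ i
      isolated sw with tail-≢ i<f sw
      ... | inj₁ ≡.refl = >⇒≢ 1≤i ∘ ≡.sym
      ... | inj₂ w≢i = w≢i

    joinedAt-i≡0 : joinedAt i i ≡ 0
    joinedAt-i≡0 = merge-hit id 0 i

    fresh-joined : FreshChain S (joinedAt i) i f k
    fresh-joined = fresh-chain
      (fixing λ {j} _ → relabel-miss (>⇒≢ (<-≤-trans i<f (m≤m+n f j))))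
      (λ sw → ≡.subst (Outside f k) (≡.sym (joinedAt-tail i<f sw)) (tail-outside N<f sw))
      (≡.subst (Outside f k) (≡.sym joinedAt-i≡0) (below-outside (≤-<-trans z≤n i<f)))

    merged : ∀ {w} → S w → merge (joinedAt i) i (suc i) w ≡ joinedAt (suc i) w
    merged sw = merge-cong {σ = joinedAt i} {τ = id} {i} {suc i} {0} {suc i}
                  joinedAt-i≡0 (joinedAt-tail i<f v-next) (joinedAt-tail i<f sw)

    joined : Value (Tail N i f) (stepEdges i f s k q ps) (k ℕ.+ suc (tailSize ps)) (joinedAt i)
               (chainCoeff s (suc k) * tailSheaf q ps
                  + pow (contraction s) (suc k) * (pow (loop (sign q)) ∣ q ∣ * tailJoined ps))
    joined = value-intro cov (chain-value s k i (suc i) f (joinedAt i) fresh-joined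
      (λ e → ℕₚ.0≢1+n (≡.trans (≡.sym joinedAt-i≡0) (≡.trans e (joinedAt-tail i<f v-next))))
      v-next
      (value-resp (agree-pointwise (joinedAt-tail i<f)) sheafApart)
      (value-resp (agree-pointwise merged) sheafJoined))

  tail-values : ∀ {L N i f} (ps : Vec (ℤ × ℤ) L) → VecAll.All (λ p → proj₁ p ≢ 0ℤ) ps →
    i ℕ.+ L ≤ N → N < f →
    TailValues (Tail N i f) (tailEdges i f ps) i (tailSize ps) (tailApart ps) (tailJoined ps)
  tail-values [] _ _ _ =
    (λ _ → value λ _ t → ≈-trans (reflexive 𝒬-empty) (*-comm δ (pow δ t))) ,
    value λ _ _ → ≈-trans (reflexive 𝒬-empty) (≈-sym (*-identityʳ _))
  tail-values {suc L} {N} {i} {f} ((p , q) ∷ ps) (p≢0 ∷ nonzero) i+L≤N N<f = step p p≢0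
    where
    1+i+L≤N : suc i ℕ.+ L ≤ N
    1+i+L≤N = ≡.subst (_≤ N) (+-suc i L) i+L≤N
    i<N : suc i ≤ N
    i<N = ≤-trans (m≤m+n (suc i) L) 1+i+L≤N
    rest : ∀ k → TailValues (Tail N (suc i) (f ℕ.+ k)) (tailEdges (suc i) (f ℕ.+ k) ps) (suc i) (tailSize ps)
                            (tailApart ps) (tailJoined ps)
    rest k = tail-values ps nonzero 1+i+L≤N (<-≤-trans N<f (m≤m+n f k))
    step : ∀ p → p ≢ 0ℤ → TailValues (Tail N i f) (tailEdges i f ((p , q) ∷ ps)) i (tailSize ((p , q) ∷ ps))
                                     (tailApart ((p , q) ∷ ps)) (tailJoined ((p , q) ∷ ps))
    step (+ zero) p≢0 = ⊥-elim (p≢0 ≡.refl)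
    step p@(+ suc k) _ = T.apart , T.joined
      where module T = TailStep Sign.+ k q ps i<N N<f (tail-covers i f ((p , q) ∷ ps) i+L≤N) (rest k)
    step p@(-[1+ k ]) _ = T.apart , T.joined
      where module T = TailStep Sign.- k q ps i<N N<f (tail-covers i f ((p , q) ∷ ps) i+L≤N) (rest k)

  Q-VFhat≈tailJoined : ∀ n m₁ m₂ (ms : Vec (ℤ × ℤ) n) →
    VecAll.All (λ p → proj₁ p ≢ 0ℤ) ((m₁ , m₂) ∷ ms) →
    Q α β δ (VFhat n m₁ m₂ ms) ≈ tailJoined ((m₁ , m₂) ∷ ms)
  Q-VFhat≈tailJoined n m₁ m₂ ms nonzero = begin
    Q α β δ (VFhat n m₁ m₂ ms)                  ≡⟨ Q≡𝒬 es _ ⟩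
    𝒬 (proj₂ (vfRest 0 f (vecToList ps))) id es ≡⟨ ≡.cong (λ k → 𝒬 k id es) vertices ⟩
    𝒬 (tailSize ps ℕ.+ 0) id es                 ≈⟨ evaluate joined identity-agrees 0 ⟩
    1# * tailJoined ps                          ≈⟨ *-identityˡ _ ⟩
    tailJoined ps ∎
    where
    ps : Vec (ℤ × ℤ) (suc n)
    ps = (m₁ , m₂) ∷ ms
    f : ℕ
    f = suc (suc n)
    es : List Edge
    es = tailEdges 0 f ps
    joined : Value (Tail (suc n) 0 f) es (tailSize ps) (joinedAt 0) (tailJoined ps)
    joined = proj₂ (tail-values ps nonzero ≤-refl (n<1+n (suc n)))
    identity-agrees : Agree (Tail (suc n) 0 f) id (joinedAt 0)
    identity-agrees = agree-pointwise λ {w} _ → ≡.sym (relabel-trivial 0 w)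
    vertices : proj₂ (vfRest 0 f (vecToList ps)) ≡ tailSize ps ℕ.+ 0
    vertices = ≡.sym (≡.trans (ℕₚ.+-identityʳ _) (+-cancelʳ-≡ f _ _ (tail-vertices 0 f ps)))

module Evaluation {c ℓ} (R : CommutativeRing c ℓ) (a a⁻ di : CommutativeRing.Carrier R) where
  open CommutativeRing R renaming (refl to ≈-refl; sym to ≈-sym; trans to ≈-trans)
  open WithRing R
  open DeletionContraction R a a⁻ (dval a a⁻)
  open VFhatExpansion R a a⁻ (dval a a⁻)
  open RingProperties ring using (-‿distribʳ-*)
  open AbelianGroupProperties +-abelianGroup using (xyx⁻¹≈y; ⁻¹-involutive)
  open NaturalCoefficientSolver commutativeSemiring using (solve; _:+_; _:*_; _:=_; con)
  open import Relation.Binary.Reasoning.Setoid setoid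

  d X Y : Carrier
  d = dval a a⁻
  X = Xval a a⁻
  Y = Yval a a⁻

  rowSum₁ rowSum₂ : M2 → Carrier
  rowSum₁ M = M2.m11 M + M2.m12 M
  rowSum₂ M = M2.m21 M + M2.m22 M

  ⊗-rowSum₁ : ∀ M N → rowSum₁ (M ⊗ N) ≈ M2.m11 M * rowSum₁ N + M2.m12 M * rowSum₂ N
  ⊗-rowSum₁ (mat p q _ _) (mat p' q' r' s') =
    solve 6 (λ p q p' q' r' s' → (p :* p' :+ q :* r') :+ (p :* q' :+ q :* s')
                                   := p :* (p' :+ q') :+ q :* (r' :+ s')) ≈-refl p q p' q' r' s'

  ⊗-rowSum₂ : ∀ M N → rowSum₂ (M ⊗ N) ≈ M2.m21 M * rowSum₁ N + M2.m22 M * rowSum₂ N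
  ⊗-rowSum₂ (mat _ _ r s) (mat p' q' r' s') =
    solve 6 (λ r s p' q' r' s' → (r :* p' :+ s :* r') :+ (r :* q' :+ s :* s')
                                   := r :* (p' :+ q') :+ s :* (r' :+ s')) ≈-refl r s p' q' r' s'

  pow-cong : ∀ {x y} m → x ≈ y → pow x m ≈ pow y m
  pow-cong zero _ = ≈-refl
  pow-cong (suc m) x≈y = *-cong x≈y (pow-cong m x≈y)

  module _ (a*a⁻≈1 : a * a⁻ ≈ 1#) (d*di≈1 : d * di ≈ 1#) where

    unit-cube : ∀ {u v} → u * v ≈ 1# → v * (- (u * u) + - (v * v)) + u ≈ - (v * v * v)
    unit-cube {u} {v} u*v≈1 = begin
      v * (- (u * u) + - (v * v)) + u           ≈⟨ +-congʳ (distribˡ v _ _) ⟩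
      (v * - (u * u) + v * - (v * v)) + u       ≈⟨ +-congʳ (+-cong (-‿distribʳ-* v _) (-‿distribʳ-* v _)) ⟨
      (- (v * (u * u)) + - (v * (v * v))) + u
        ≈⟨ +-congʳ (+-cong (-‿cong vuu≈u) (-‿cong (≈-sym (*-assoc v v v)))) ⟩
      (- u + - (v * v * v)) + u                 ≈⟨ +-congˡ (⁻¹-involutive u) ⟨
      (- u + - (v * v * v)) + - - u             ≈⟨ xyx⁻¹≈y (- u) _ ⟩
      - (v * v * v) ∎
      where
      vuu≈u : v * (u * u) ≈ u
      vuu≈u = ≈-trans (solve 2 (λ u v → v :* (u :* u) := (u :* v) :* u) ≈-refl u v)
                      (≈-trans (*-congʳ u*v≈1) (*-identityˡ u))

    pendant₊≈X : pendant Sign.+ ≈ X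
    pendant₊≈X = unit-cube a*a⁻≈1

    pendant₋≈Y : pendant Sign.- ≈ Y
    pendant₋≈Y = ≈-trans (+-congʳ (*-congˡ (+-comm _ _))) (unit-cube (≈-trans (*-comm a⁻ a) a*a⁻≈1))

    zpow-pendant : ∀ p → zpow X Y p ≈ pow (pendant (sign p)) ∣ p ∣
    zpow-pendant (+ m) = pow-cong m (≈-sym pendant₊≈X)
    zpow-pendant -[1+ m ] = pow-cong (suc m) (≈-sym pendant₋≈Y)

    zpow-loop : ∀ q → zpow Y X q ≈ pow (loop (sign q)) ∣ q ∣
    zpow-loop (+ m) = pow-cong m (≈-sym pendant₋≈Y)
    zpow-loop -[1+ m ] = pow-cong (suc m) (≈-trans (≈-sym pendant₊≈X) (+-comm _ _))

    zpow-contraction : ∀ p → zpow a a⁻ p ≡ pow (contraction (sign p)) ∣ p ∣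
    zpow-contraction (+ _) = ≡.refl
    zpow-contraction -[1+ _ ] = ≡.refl

    zpow-deletion : ∀ q → zpow a⁻ a q ≡ pow (deletion (sign q)) ∣ q ∣
    zpow-deletion (+ _) = ≡.refl
    zpow-deletion -[1+ _ ] = ≡.refl

    cancel : ∀ u → (d * di) * u ≈ u
    cancel u = ≈-trans (*-congʳ d*di≈1) (*-identityˡ u)

    quotient : ∀ {u v w} → u ≈ v * d + w → v ≈ (u - w) * di
    quotient {u} {v} {w} u≈ = begin
      v                   ≈⟨ cancel v ⟨
      (d * di) * v        ≈⟨ solve 3 (λ d di v → (d :* di) :* v := (v :* d) :* di) ≈-refl d di v ⟩
      (v * d) * di        ≈⟨ *-congʳ (xyx⁻¹≈y w (v * d)) ⟨
      (w + v * d - w) * di ≈⟨ *-congʳ (+-congʳ (≈-trans (+-comm w _) (≈-sym u≈))) ⟩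
      (u - w) * di ∎

    chainCoeff≈ : ∀ p → chainCoeff (sign p) ∣ p ∣ ≈ (zpow X Y p - zpow a a⁻ p) * di
    chainCoeff≈ p = quotient (≈-trans (zpow-pendant p)
      (≈-trans (pow-pendant (sign p) ∣ p ∣) (+-congˡ (reflexive (≡.sym (zpow-contraction p))))))

    sheafCoeff≈ : ∀ q → sheafCoeff (sign q) ∣ q ∣ ≈ (zpow Y X q - zpow a⁻ a q) * di
    sheafCoeff≈ q = quotient (≈-trans (zpow-loop q)
      (≈-trans (pow-loop (sign q) ∣ q ∣) (+-congˡ (reflexive (≡.sym (zpow-deletion q))))))

    tail-matrix-form : ∀ {L} (ps : Vec (ℤ × ℤ) L) →
      tailApart ps ≈ d * (pow di L * rowSum₁ (Aprod a a⁻ di ps))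
        × tailJoined ps ≈ pow di L * rowSum₂ (Aprod a a⁻ di ps)
    tail-matrix-form [] =
      solve 1 (λ d → d := d :* (con 1 :* (con 1 :+ con 0))) ≈-refl d ,
      solve 0 (con 1 := con 1 :* (con 0 :+ con 1)) ≈-refl
    tail-matrix-form {suc L} ((p , q) ∷ ps) = apart , joined
      where
      x xA b y D w₁ w₂ Z : Carrier
      P : M2
      x = zpow X Y p
      xA = zpow a a⁻ p
      b = zpow a⁻ a q
      y = zpow Y X q
      D = pow di L
      P = Aprod a a⁻ di ps
      w₁ = rowSum₁ P
      w₂ = rowSum₂ P
      Z = b * d * w₁ + (y - b) * di * w₂

      sheaf≈ : tailSheaf q ps ≈ D * Z
      sheaf≈ = begin
        pow (deletion (sign q)) ∣ q ∣ * tailApart ps + sheafCoeff (sign q) ∣ q ∣ * tailJoined ps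
          ≈⟨ +-cong (*-cong (reflexive (≡.sym (zpow-deletion q))) (proj₁ (tail-matrix-form ps)))
                    (*-cong (sheafCoeff≈ q) (proj₂ (tail-matrix-form ps))) ⟩
        b * (d * (D * w₁)) + ((y - b) * di) * (D * w₂)
          ≈⟨ solve 7 (λ b d D w₁ yb di w₂ → b :* (d :* (D :* w₁)) :+ (yb :* di) :* (D :* w₂)
                        := D :* (b :* d :* w₁ :+ yb :* di :* w₂)) ≈-refl b d D w₁ (y - b) di w₂ ⟩
        D * Z ∎

      apart : tailApart ((p , q) ∷ ps) ≈ d * (pow di (suc L) * rowSum₁ (Amat a a⁻ di (p , q) ⊗ P))
      apart = begin
        pow (pendant (sign p)) ∣ p ∣ * tailSheaf q ps ≈⟨ *-cong (≈-sym (zpow-pendant p)) sheaf≈ ⟩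
        x * (D * Z)                                   ≈⟨ cancel _ ⟨
        (d * di) * (x * (D * Z))
          ≈⟨ solve 8 (λ d di D x b yb w₁ w₂ → (d :* di) :* (x :* (D :* (b :* d :* w₁ :+ yb :* di :* w₂)))
                        := d :* ((di :* D) :* ((x :* b :* d) :* w₁ :+ (x :* yb :* di) :* w₂)))
                     ≈-refl d di D x b (y - b) w₁ w₂ ⟩
        d * ((di * D) * ((x * b * d) * w₁ + (x * (y - b) * di) * w₂))
          ≈⟨ *-congˡ (*-congˡ (⊗-rowSum₁ (Amat a a⁻ di (p , q)) P)) ⟨
        d * (pow di (suc L) * rowSum₁ (Amat a a⁻ di (p , q) ⊗ P)) ∎

      joined : tailJoined ((p , q) ∷ ps) ≈ pow di (suc L) * rowSum₂ (Amat a a⁻ di (p , q) ⊗ P)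
      joined = begin
        chainCoeff (sign p) ∣ p ∣ * tailSheaf q ps
          + pow (contraction (sign p)) ∣ p ∣ * (pow (loop (sign q)) ∣ q ∣ * tailJoined ps)
          ≈⟨ +-cong (*-cong (chainCoeff≈ p) sheaf≈)
                    (*-cong (reflexive (≡.sym (zpow-contraction p)))
                            (*-cong (≈-sym (zpow-loop q)) (proj₂ (tail-matrix-form ps)))) ⟩
        ((x - xA) * di) * (D * Z) + xA * (y * (D * w₂))
          ≈⟨ +-congˡ (cancel _) ⟨
        ((x - xA) * di) * (D * Z) + (d * di) * (xA * (y * (D * w₂)))
          ≈⟨ solve 10 (λ d di D xxA xA y b yb w₁ w₂ →
                        (xxA :* di) :* (D :* (b :* d :* w₁ :+ yb :* di :* w₂)) :+ (d :* di) :* (xA :* (y :* (D :* w₂)))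
                        := (di :* D) :* ((xxA :* b :* d) :* w₁ :+ (xxA :* yb :* di :+ xA :* y :* d) :* w₂))
                     ≈-refl d di D (x - xA) xA y b (y - b) w₁ w₂ ⟩
        (di * D) * (((x - xA) * b * d) * w₁ + ((x - xA) * (y - b) * di + xA * y * d) * w₂)
          ≈⟨ *-congˡ (⊗-rowSum₂ (Amat a a⁻ di (p , q)) P) ⟨
        pow di (suc L) * rowSum₂ (Amat a a⁻ di (p , q) ⊗ P) ∎

    rhs-matrix-form : ∀ n m₁ m₂ (ms : Vec (ℤ × ℤ) n) →
      rhs a a⁻ di n m₁ m₂ ms ≈ pow di (suc n) * rowSum₂ (Aprod a a⁻ di ((m₁ , m₂) ∷ ms))
    rhs-matrix-form n m₁ m₂ ms = begin
      pow di (n ℕ.+ 2) * E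
        ≡⟨ ≡.cong (λ k → pow di k * E) (ℕₚ.+-comm n 2) ⟩
      (di * (di * D)) * E
        ≈⟨ solve 10 (λ d di D xxA xA y b yb w₁ w₂ →
                       (di :* (di :* D)) :* ((xxA :* b :* (d :* d)) :* w₁ :+ (xA :* y :* (d :* d) :+ xxA :* yb) :* w₂)
                       := (di :* D) :* ((d :* di) :* (xxA :* b :* d) :* w₁
                                         :+ (xxA :* yb :* di :+ (d :* di) :* (xA :* y :* d)) :* w₂))
                     ≈-refl d di D (x - xA) xA y b (y - b) w₁ w₂ ⟩
      (di * D) * ((d * di) * ((x - xA) * b * d) * w₁ + ((x - xA) * (y - b) * di + (d * di) * (xA * y * d)) * w₂)
        ≈⟨ *-congˡ (+-cong (*-congʳ (cancel _)) (*-congʳ (+-congˡ (cancel _)))) ⟩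
      (di * D) * (((x - xA) * b * d) * w₁ + ((x - xA) * (y - b) * di + xA * y * d) * w₂)
        ≈⟨ *-congˡ (⊗-rowSum₂ (Amat a a⁻ di (m₁ , m₂)) P) ⟨
      pow di (suc n) * rowSum₂ (Aprod a a⁻ di ((m₁ , m₂) ∷ ms)) ∎
      where
      x xA b y D w₁ w₂ E : Carrier
      P : M2
      x = zpow X Y m₁
      xA = zpow a a⁻ m₁
      b = zpow a⁻ a m₂
      y = zpow Y X m₂
      D = pow di n
      P = Aprod a a⁻ di ms
      w₁ = rowSum₁ P
      w₂ = rowSum₂ P
      E = ((x - xA) * b * (d * d)) * w₁ + (xA * y * (d * d) + (x - xA) * (y - b)) * w₂

-- Only the chain lengths m₁, m₃, m₅, … must be nonzero, and n = 0 is allowed as well.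

theorem12 : ∀ {c ℓ : Level} (R : CommutativeRing c ℓ) →
  let open CommutativeRing R
      open WithRing R
  in (a a⁻ di : Carrier) → a * a⁻ ≈ 1# → dval a a⁻ * di ≈ 1# →
     (n : ℕ) → 1 ≤ n → (m₁ m₂ : ℤ) (ms : Vec (ℤ × ℤ) n) →
     m₁ ≢ 0ℤ → m₂ ≢ 0ℤ → All (λ p → proj₁ p ≢ 0ℤ × proj₂ p ≢ 0ℤ) ms →
     bracket a a⁻ n m₁ m₂ ms ≈ rhs a a⁻ di n m₁ m₂ ms
theorem12 R a a⁻ di a*a⁻≈1 d*di≈1 n _ m₁ m₂ ms m₁≢0 _ ms≢0 = begin
  bracket a a⁻ n m₁ m₂ ms
    ≈⟨ Q-VFhat≈tailJoined n m₁ m₂ ms (m₁≢0 ∷ VecAll.map proj₁ ms≢0) ⟩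
  tailJoined ((m₁ , m₂) ∷ ms)
    ≈⟨ proj₂ (tail-matrix-form a*a⁻≈1 d*di≈1 ((m₁ , m₂) ∷ ms)) ⟩
  pow di (suc n) * rowSum₂ (Aprod a a⁻ di ((m₁ , m₂) ∷ ms))
    ≈⟨ rhs-matrix-form a*a⁻≈1 d*di≈1 n m₁ m₂ ms ⟨
  rhs a a⁻ di n m₁ m₂ ms ∎
  where
  open CommutativeRing R using (setoid; _*_)
  open WithRing R using (bracket; rhs; pow; Aprod; dval)
  open VFhatExpansion R a a⁻ (dval a a⁻) using (Q-VFhat≈tailJoined; tailJoined)
  open Evaluation R a a⁻ di using (tail-matrix-form; rhs-matrix-form; rowSum₂)
  open import Relation.Binary.Reasoning.Setoid setoid
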